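{- Let $n\ge 1$ and $1\le m\le n$ be integers and consider the rectangular flag-shaped blocker $B_n(m,m-1)$ of all $n\times n$ $123$-avoiding permutation matrices (here $t=m-1$). Then the face of $\Omega_n(\overline{123})$ determined by $B_n(m,m-1)$ attains the maximum dimension $(n-1)^2+1-t(n-m)=(n-1)^2+1-(m-1)(n-m)$; that is, the maximum number of linearly independent (as real $n\times n$ matrices) $n\times n$ $123$-avoiding permutation matrices each having exactly one $1$ in a position of $B_n(m,m-1)$ equals $(n-1)^2+1-(m-1)(n-m)$.
   Context: A permutation matrix $P$ contains a $123$-pattern if $I_3$ is a submatrix of $P$; otherwise $P$ is $123$-avoiding. $\Omega_n(\overline{123})$ denotes the convex hull of the $n\times n$ $123$-avoiding permutation matrices. A set of positions is a blocker if every $n\times n$ $123$-avoiding permutation matrix has a $1$ in one of its positions. In this paper, the dimension of the face of $\Omega_n(\overline{123})$ determined by a minimum blocker $Q$ is taken to be the maximum number of linearly independent $123$-avoiding permutation matrices having exactly one $1$ in a position of $Q$. For integers $1\le m\le n$, $0\le t\le m-1$, the flag-shaped blocker $B_n(m,t)$ is the union of $\{(i,m): 1\le i\le n-t\}$ and $\{(i,j): 1\le i\le n-m+1,\ m-t\le j\le m-1\}$, positions written as (row, column); thus $B_n(m,m-1)$ is the rectangle of rows $1,\dots,n-m+1$ and columns $1,\dots,m$. -}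

module Defs where

open import Data.Nat using (ℕ; zero; suc; _+_; _*_; _∸_; _^_; _≤_; _<_)
open import Data.Nat.Properties using (_≤?_; _<?_)
open import Data.Fin using (Fin; toℕ; _≟_)
open import Data.Fin.Permutation using (Permutation′; _⟨$⟩ʳ_)
open import Data.Bool using (Bool; true; false; _∧_; _∨_)
open import Data.List using (length; filter; allFin)
open import Data.Product using (Σ; _×_; ∃)
open import Relation.Nullary using (¬_; Dec; yes; no)
open import Relation.Nullary.Decidable using (⌊_⌋)
open import Relation.Binary.PropositionalEquality using (_≡_)
open import Data.Rational using (ℚ; 0ℚ; 1ℚ) renaming (_+_ to _+ℚ_; _*_ to _*ℚ_)

-- Matrix positions are written (row, column), rows and columns indexed by Fin n
-- (0-based); the paper's 1-based index of i : Fin n is suc (toℕ i).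

-- A permutation π corresponds to the permutation matrix P with P(i,j) = 1 iff π i = j.
-- P contains a 123-pattern iff I₃ is a submatrix: rows i₁<i₂<i₃, columns j₁<j₂<j₃
-- with P(i₁,j₁)=P(i₂,j₂)=P(i₃,j₃)=1.
Contains123 : {n : ℕ} → Permutation′ n → Set
Contains123 {n} π =
  Σ (Fin n) λ i₁ → Σ (Fin n) λ i₂ → Σ (Fin n) λ i₃ →
  Σ (Fin n) λ j₁ → Σ (Fin n) λ j₂ → Σ (Fin n) λ j₃ →
    (toℕ i₁ < toℕ i₂) × (toℕ i₂ < toℕ i₃) ×
    (toℕ j₁ < toℕ j₂) × (toℕ j₂ < toℕ j₃) ×
    (π ⟨$⟩ʳ i₁ ≡ j₁) × (π ⟨$⟩ʳ i₂ ≡ j₂) × (π ⟨$⟩ʳ i₃ ≡ j₃)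

Avoids123 : {n : ℕ} → Permutation′ n → Set
Avoids123 π = ¬ Contains123 π

-- Flag-shaped blocker B_n(m,t), on 1-based positions (r, c):
--   { (r, m) : 1 ≤ r ≤ n - t } ∪ { (r, c) : 1 ≤ r ≤ n-m+1, m-t ≤ c ≤ m-1 }.
inFlag : (n m t : ℕ) → (r c : ℕ) → Bool
inFlag n m t r c =
  (⌊ c Data.Nat.≟ m ⌋ ∧ ⌊ 1 ≤? r ⌋ ∧ ⌊ r ≤? n ∸ t ⌋)
  ∨ (⌊ 1 ≤? r ⌋ ∧ ⌊ r ≤? (n ∸ m) + 1 ⌋ ∧ ⌊ m ∸ t ≤? c ⌋ ∧ ⌊ c ≤? m ∸ 1 ⌋)

InFlag : (n m t : ℕ) → Fin n → Fin n → Bool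
InFlag n m t i j = inFlag n m t (suc (toℕ i)) (suc (toℕ j))

onesInFlag : (n m t : ℕ) → Permutation′ n → ℕ
onesInFlag n m t π =
  length (filter (λ i → InFlag n m t i (π ⟨$⟩ʳ i) Data.Bool.≟ true) (allFin n))

permMatrix : {n : ℕ} → Permutation′ n → Fin n → Fin n → ℚ
permMatrix π i j with π ⟨$⟩ʳ i ≟ j
... | yes _ = 1ℚ
... | no _  = 0ℚ

sumFin : (k : ℕ) → (Fin k → ℚ) → ℚ
sumFin zero    f = 0ℚ
sumFin (suc k) f = f Data.Fin.zero +ℚ sumFin k (λ a → f (Data.Fin.suc a))

LinIndep : {n k : ℕ} → (Fin k → Fin n → Fin n → ℚ) → Set
LinIndep {n} {k} M =
  (c : Fin k → ℚ) →
  (∀ i j → sumFin k (λ a → c a *ℚ M a i j) ≡ 0ℚ) →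
  ∀ a → c a ≡ 0ℚ

OnFace : (n m t : ℕ) → Permutation′ n → Set
OnFace n m t π = Avoids123 π × (onesInFlag n m t π ≡ 1)

MaxIndepCount : (n m t : ℕ) → ℕ → Set
MaxIndepCount n m t d =
  (Σ (Fin d → Permutation′ n) λ F →
     (∀ a → OnFace n m t (F a)) × LinIndep (λ a → permMatrix (F a)))
  × (∀ (k : ℕ) (F : Fin k → Permutation′ n) →
       (∀ a → OnFace n m t (F a)) → LinIndep (λ a → permMatrix (F a)) → k ≤ d)

{-# OPTIONS --safe #-}
module Submission where

-- Write n = a + b + 1 and m = b + 1. The flag is a rectangle of a + 1 rows and
-- b + 1 columns, so inclusion–exclusion shows that a permutation has exactly
-- one 1 in it iff it has none in the opposite b × a corner block.
-- Hence a linear combination of such permutation matrices is determined by the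
-- sum of its coefficients and by its entries outside the first row, the first
-- column and the opposite block: 1 + (a + b)² − ba numbers.
-- Conversely, with the order of the columns reversed (123 becomes 321), the
-- permutation sending i to j and monotone elsewhere (a cycle on an interval)
-- avoids 321. Off row i it moves every row by at most one, so its matrix is the
-- only one with a 1 at (i , j) when |i − j| ≥ 2; the remaining transpositions
-- of neighbours and the identity are then separated in turn. Dropping the
-- cycles with (i , j) in the block leaves exactly the required number.

open import Defs
open import Algebra.Bundles using (CommutativeRing)
open import Data.Bool using (Bool; true; false; T; not; _∧_; _∨_)
open import Data.Bool.Properties using (T-∧; T-∨; T-≡; ∧-zeroʳ)
open import Data.Empty using (⊥)
open import Data.Fin using (Fin; zero; suc; toℕ; inject₁; opposite; punchIn; punchOut; _↑ˡ_; _↑ʳ_; splitAt)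
open import Data.Fin.Permutation using (Permutation′; _⟨$⟩ʳ_; _⟨$⟩ˡ_; inverseˡ; inverseʳ; insert; insert-punchIn; reverse; _∘ₚ_; id)
open import Data.Fin.Properties as Fin using (all?; ¬∀⟶∃¬; punchIn-punchOut; punchInᵢ≢i; punchIn-mono-≤; punchIn-cancel-≤; opposite-prop; opposite-involutive; toℕ-inject₁; inject₁-injective; toℕ-↑ˡ; toℕ-↑ʳ; toℕ<n; ↑ˡ-injective; ↑ʳ-injective; splitAt-↑ˡ; splitAt-↑ʳ; splitAt⁻¹-↑ˡ; splitAt⁻¹-↑ʳ; +↔⊎; *↔×)
open import Data.List using (length; filter; tabulate)
open import Data.Nat using (ℕ; zero; suc; _≤_; _<_; _+_; _*_; _∸_; _^_; z≤n; s≤s; s≤s⁻¹; _<ᵇ_)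
import Data.Nat.Properties as ℕ
open import Data.Nat.Induction using (<-wellFounded)
open import Data.Nat.Tactic.RingSolver using (solve-∀)
open import Data.Product using (∃; Σ; _×_; _,_; proj₁; proj₂)
open import Data.Product.Properties using (,-injective)
open import Data.Rational as ℚ using (ℚ; 0ℚ; 1ℚ; 1/_)
import Data.Rational.Properties as ℚ
open import Data.Rational.Solver using (module +-*-Solver)
open import Data.Sum using (_⊎_; inj₁; inj₂; [_,_]′)
open import Data.Sum.Function.Propositional using (_⊎-↔_; _⊎-⇔_)
open import Data.Product.Function.NonDependent.Propositional using (_×-⇔_)
open import Function.Properties.Equivalence using () renaming (trans to ⇔-trans)
open import Data.Unit using (tt)
open import Data.Vec.Functional using (_∷_)
open import Function using (_∘_; _↔_; Inverse; Injective; Equivalence; _⇔_; mk⇔)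
open import Function.Properties.Inverse using (↔-trans)
open import Induction.WellFounded using (Acc; acc)
open import Relation.Binary.PropositionalEquality
open import Relation.Nullary using (¬_; Dec; yes; no; contradiction)
open import Relation.Nullary.Decidable using (⌊_⌋; toWitness; fromWitness)

open import Algebra.Properties.Semiring.Sum (CommutativeRing.semiring ℚ.+-*-commutativeRing)
  using (sum; sum-cong-≗; sum-remove; sum-replicate-zero; ∑-distrib-+; ∑-comm; *-distribˡ-sum; *-distribʳ-sum)
open import Algebra.Properties.CommutativeMonoid.Sum ℕ.+-0-commutativeMonoid as ℕΣ
  using () renaming (sum to sumℕ)

private
  variable
    a k n : ℕ

-- Linear algebra over ℚ

sumFin≡sum : ∀ k (f : Fin k → ℚ) → sumFin k f ≡ sum f
sumFin≡sum zero    f = refl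
sumFin≡sum (suc k) f = cong (f zero ℚ.+_) (sumFin≡sum k (f ∘ suc))

sum-zero : (f : Fin k → ℚ) → (∀ i → f i ≡ 0ℚ) → sum f ≡ 0ℚ
sum-zero {k} f f≡0 = trans (sum-cong-≗ f≡0) (sum-replicate-zero k)

sum-single : ∀ (f : Fin k → ℚ) i → (∀ j → j ≢ i → f j ≡ 0ℚ) → sum f ≡ f i
sum-single {suc k} f i f≡0 = begin
  sum f                        ≡⟨ sum-remove {i = i} f ⟩
  f i ℚ.+ sum (f ∘ punchIn i)  ≡⟨ cong (f i ℚ.+_) (sum-zero _ λ j → f≡0 _ (punchInᵢ≢i i j)) ⟩
  f i ℚ.+ 0ℚ                   ≡⟨ ℚ.+-identityʳ (f i) ⟩
  f i                          ∎
  where open ≡-Reasoning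

cover : ∀ {P : Fin (suc n) → Set} i → P i → (∀ j → P (punchIn i j)) → ∀ j → P j
cover {P = P} i pᵢ p j with i Fin.≟ j
... | yes refl = pᵢ
... | no i≢j = subst P (punchIn-punchOut i≢j) (p (punchOut i≢j))

-- Gaussian elimination. A zero first vector is itself a relation, which covers `d` = 0; otherwise a
-- nonzero entry of it clears its column from the other vectors, and both are dropped.
dependent : ∀ d → d < k → (v : Fin k → Fin d → ℚ) →
            ∃ λ (c : Fin k → ℚ) → (∃ λ x → c x ≢ 0ℚ) × (∀ j → sum (λ x → c x ℚ.* v x j) ≡ 0ℚ)
dependent {suc k} d d<k v with all? (λ j → v zero j ℚ.≟ 0ℚ)
... | yes v₀≡0 = 1ℚ ∷ (λ _ → 0ℚ) , (zero , λ ()) , λ j →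
  sum-zero (λ x → (1ℚ ∷ (λ _ → 0ℚ)) x ℚ.* v x j)
    λ { zero → trans (ℚ.*-identityˡ _) (v₀≡0 j) ; (suc x) → ℚ.*-zeroˡ (v (suc x) j) }
... | no v₀≢0 with ¬∀⟶∃¬ _ _ (λ j → v zero j ℚ.≟ 0ℚ) v₀≢0
dependent {suc k} (suc d) d<k v | no _ | j₀ , p≢0 =
  let c , (x , cₓ≢0) , u≡0 = dependent d (s≤s⁻¹ d<k) (λ y j → u y (punchIn j₀ j))
      s = sum (λ y → c y ℚ.* r y)
  -- The combinations of the original and of the cleared vectors differ by `s` times the first
  -- vector; the coefficient `- s` cancels this.
  in (ℚ.- s) ∷ c , (suc x , cₓ≢0) , λ j → begin
    ℚ.- s ℚ.* v zero j ℚ.+ sum (λ y → c y ℚ.* v (suc y) j)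
      ≡⟨ cong (ℚ.- s ℚ.* v zero j ℚ.+_) (trans (sum-cong-≗ (λ y → split (c y) (r y) (v zero j) (v (suc y) j)))
           (∑-distrib-+ (λ y → c y ℚ.* r y ℚ.* v zero j) _)) ⟩
    ℚ.- s ℚ.* v zero j ℚ.+ (sum (λ y → c y ℚ.* r y ℚ.* v zero j) ℚ.+ sum (λ y → c y ℚ.* u y j))
      ≡⟨ cong₂ (λ p q → ℚ.- s ℚ.* v zero j ℚ.+ (p ℚ.+ q)) (sym (*-distribʳ-sum (v zero j) (λ y → c y ℚ.* r y)))
           (cover {P = λ j → sum (λ y → c y ℚ.* u y j) ≡ 0ℚ} j₀
             (sum-zero _ λ y → trans (cong (c y ℚ.*_) (u₀≡0 y)) (ℚ.*-zeroʳ (c y))) u≡0 j) ⟩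
    ℚ.- s ℚ.* v zero j ℚ.+ (s ℚ.* v zero j ℚ.+ 0ℚ)
      ≡⟨ solve 2 (λ s w → :- s :* w :+ (s :* w :+ con 0ℚ) := con 0ℚ) refl s (v zero j) ⟩
    0ℚ ∎
  where
  open ≡-Reasoning
  open +-*-Solver
  instance _ = ℚ.≢-nonZero p≢0
  p = v zero j₀
  r : Fin k → ℚ
  r y = v (suc y) j₀ ℚ.* 1/ p
  u : Fin k → Fin (suc d) → ℚ
  u y j = v (suc y) j ℚ.- r y ℚ.* v zero j
  split : ∀ c r w z → c ℚ.* z ≡ c ℚ.* r ℚ.* w ℚ.+ c ℚ.* (z ℚ.- r ℚ.* w)
  split = solve 4 (λ c r w z → c :* z := c :* r :* w :+ c :* (z :- r :* w)) refl
  u₀≡0 : ∀ y → u y j₀ ≡ 0ℚ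
  u₀≡0 y = begin
    z ℚ.- z ℚ.* 1/ p ℚ.* p    ≡⟨ cong (λ t → z ℚ.- t) (ℚ.*-assoc z (1/ p) p) ⟩
    z ℚ.- z ℚ.* (1/ p ℚ.* p)  ≡⟨ cong (λ t → z ℚ.- z ℚ.* t) (ℚ.*-inverseˡ p) ⟩
    z ℚ.- z ℚ.* 1ℚ            ≡⟨ solve 1 (λ z → z :- z :* con 1ℚ := con 0ℚ) refl z ⟩
    0ℚ                        ∎
    where z = v (suc y) j₀

-- At the pivot of `x`, terms of smaller rank vanish by induction and all others because their
-- matrices do. Ranks may tie, so whole layers are eliminated at once.
triangular⇒linIndep :
  (M : Fin k → Fin n → Fin n → ℚ) (rank : Fin k → ℕ) (row col : Fin k → Fin n) →
  (∀ x → M x (row x) (col x) ≡ 1ℚ) →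
  (∀ x y → y ≢ x → rank x ≤ rank y → M y (row x) (col x) ≡ 0ℚ) →
  LinIndep M
triangular⇒linIndep {k} M rank row col pivot≡1 rest≡0 c Σ≡0 x = go x (<-wellFounded (rank x))
  where
  open ≡-Reasoning
  go : ∀ x → Acc _<_ (rank x) → c x ≡ 0ℚ
  go x (acc rec) = begin
    c x                                              ≡⟨ ℚ.*-identityʳ (c x) ⟨
    c x ℚ.* 1ℚ                                       ≡⟨ cong (c x ℚ.*_) (pivot≡1 x) ⟨
    c x ℚ.* M x (row x) (col x)                      ≡⟨ sum-single _ x off ⟨
    sum (λ y → c y ℚ.* M y (row x) (col x))          ≡⟨ sumFin≡sum k _ ⟨
    sumFin k (λ y → c y ℚ.* M y (row x) (col x))     ≡⟨ Σ≡0 (row x) (col x) ⟩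
    0ℚ                                               ∎
    where
    off : ∀ y → y ≢ x → c y ℚ.* M y (row x) (col x) ≡ 0ℚ
    off y y≢x with rank y ℕ.<? rank x
    ... | yes y<x = trans (cong (ℚ._* _) (go y (rec y<x))) (ℚ.*-zeroˡ (M y (row x) (col x)))
    ... | no y≮x = trans (cong (c y ℚ.*_) (rest≡0 x y y≢x (ℕ.≮⇒≥ y≮x))) (ℚ.*-zeroʳ (c y))

-- Row sums give the first column below the corner; column sums then give the whole first row.
zeroMinor⇒zero :
  (M : Fin (suc n) → Fin (suc n) → ℚ) →
  (∀ i → sum (M i) ≡ 0ℚ) → (∀ j → sum (λ i → M i j) ≡ 0ℚ) →
  (∀ i j → M (suc i) (suc j) ≡ 0ℚ) → ∀ i j → M i j ≡ 0ℚ
zeroMinor⇒zero M rows cols minor = entry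
  where
  below : ∀ i j → M (suc i) j ≡ 0ℚ
  below i (suc j) = minor i j
  below i zero = trans
    (sym (sum-single (M (suc i)) zero λ { zero 0≢0 → contradiction refl 0≢0 ; (suc j) _ → minor i j }))
    (rows (suc i))
  entry : ∀ i j → M i j ≡ 0ℚ
  entry (suc i) j = below i j
  entry zero j = trans
    (sym (sum-single (λ i → M i j) zero λ { zero 0≢0 → contradiction refl 0≢0 ; (suc i) _ → below i j }))
    (cols j)

-- Row and column sums of permutation matrices

permMatrix-hit : ∀ (π : Permutation′ n) {i j} → π ⟨$⟩ʳ i ≡ j → permMatrix π i j ≡ 1ℚ
permMatrix-hit π {i} {j} eq with π ⟨$⟩ʳ i Fin.≟ j
... | yes _ = refl
... | no ne = contradiction eq ne

permMatrix-miss : ∀ (π : Permutation′ n) {i j} → π ⟨$⟩ʳ i ≢ j → permMatrix π i j ≡ 0ℚ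
permMatrix-miss π {i} {j} ne with π ⟨$⟩ʳ i Fin.≟ j
... | yes eq = contradiction eq ne
... | no _ = refl

permMatrix-row : ∀ (π : Permutation′ n) i → sum (permMatrix π i) ≡ 1ℚ
permMatrix-row π i = trans
  (sum-single _ (π ⟨$⟩ʳ i) λ j j≢πi → permMatrix-miss π (j≢πi ∘ sym))
  (permMatrix-hit π refl)

permMatrix-col : ∀ (π : Permutation′ n) j → sum (λ i → permMatrix π i j) ≡ 1ℚ
permMatrix-col π j = trans
  (sum-single _ (π ⟨$⟩ˡ j) λ i i≢πj → permMatrix-miss π λ { refl → i≢πj (sym (inverseˡ π)) })
  (permMatrix-hit π (inverseʳ π))

-- Every line of a permutation matrix sums to 1, so every line of the combination sums to `sum c`,
-- which is zero.
zeroMinor⇒dependent :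
  (F : Fin k → Permutation′ (suc n)) (c : Fin k → ℚ) → sum c ≡ 0ℚ →
  (∀ i j → sum (λ x → c x ℚ.* permMatrix (F x) (suc i) (suc j)) ≡ 0ℚ) →
  ∀ i j → sum (λ x → c x ℚ.* permMatrix (F x) i j) ≡ 0ℚ
zeroMinor⇒dependent {k} {n} F c Σc≡0 = zeroMinor⇒zero _
  (λ i → line (λ x j → permMatrix (F x) i j) (λ x → permMatrix-row (F x) i))
  (λ j → line (λ x i → permMatrix (F x) i j) (λ x → permMatrix-col (F x) j))
  where
  open ≡-Reasoning
  line : (L : Fin k → Fin (suc n) → ℚ) → (∀ x → sum (L x) ≡ 1ℚ) →
         sum (λ j → sum (λ x → c x ℚ.* L x j)) ≡ 0ℚ
  line L ΣL≡1 = begin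
    sum (λ j → sum (λ x → c x ℚ.* L x j))  ≡⟨ ∑-comm (λ x j → c x ℚ.* L x j) ⟨
    sum (λ x → sum (λ j → c x ℚ.* L x j))  ≡⟨ sum-cong-≗ (λ x → sym (*-distribˡ-sum (c x) (L x))) ⟩
    sum (λ x → c x ℚ.* sum (L x))          ≡⟨ sum-cong-≗ (λ x → trans (cong (c x ℚ.*_) (ΣL≡1 x)) (ℚ.*-identityʳ (c x))) ⟩
    sum c                                  ≡⟨ Σc≡0 ⟩
    0ℚ                                     ∎

-- Counting ones in the flag

indicator : Bool → ℕ
indicator true  = 1
indicator false = 0

length-filter-tabulate : ∀ (f : Fin n → Bool) (g : Fin k → Fin n) →
  length (filter (λ i → f i Data.Bool.≟ true) (tabulate g)) ≡ sumℕ (indicator ∘ f ∘ g)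
length-filter-tabulate {k = zero}  f g = refl
length-filter-tabulate {k = suc k} f g with f (g zero)
... | true  = cong suc (length-filter-tabulate f (g ∘ suc))
... | false = length-filter-tabulate f (g ∘ suc)

sumℕ-ones : ∀ n → sumℕ {n} (λ _ → 1) ≡ n
sumℕ-ones zero    = refl
sumℕ-ones (suc n) = cong suc (sumℕ-ones n)

sumℕ≡0⇒all≡0 : (f : Fin n → ℕ) → sumℕ f ≡ 0 → ∀ i → f i ≡ 0
sumℕ≡0⇒all≡0 f Σ≡0 zero    = ℕ.m+n≡0⇒m≡0 (f zero) Σ≡0
sumℕ≡0⇒all≡0 f Σ≡0 (suc i) = sumℕ≡0⇒all≡0 (f ∘ suc) (ℕ.m+n≡0⇒n≡0 (f zero) Σ≡0) i

sumℕ-initial : k ≤ n → sumℕ {n} (λ i → indicator (toℕ i <ᵇ k)) ≡ k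
sumℕ-initial {n = n} z≤n = ℕΣ.sum-replicate-zero n
sumℕ-initial (s≤s k≤n) = cong suc (sumℕ-initial k≤n)

⇔⇒≡ : ∀ {x y} → (T x → T y) → (T y → T x) → x ≡ y
⇔⇒≡ {true}  {true}  _ _ = refl
⇔⇒≡ {true}  {false} f _ with () ← f tt
⇔⇒≡ {false} {true}  _ g with () ← g tt
⇔⇒≡ {false} {false} _ _ = refl

-- The decision procedures are kept abstract, as they partially reduce in inFlag.
flag-⇔ : {A B C D E F : Set}
  (A? : Dec A) (B? : Dec B) (C? : Dec C) (D? : Dec D) (E? : Dec E) (F? : Dec F) →
  T ((⌊ A? ⌋ ∧ ⌊ B? ⌋ ∧ ⌊ C? ⌋) ∨ (⌊ B? ⌋ ∧ ⌊ D? ⌋ ∧ ⌊ E? ⌋ ∧ ⌊ F? ⌋)) ⇔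
  ((A × B × C) ⊎ (B × D × E × F))
flag-⇔ A? B? C? D? E? F? =
  ⇔-trans T-∨
    ((⇔-trans T-∧ (T-⌊⌋ A? ×-⇔ ⇔-trans T-∧ (T-⌊⌋ B? ×-⇔ T-⌊⌋ C?)))
      ⊎-⇔
     (⇔-trans T-∧ (T-⌊⌋ B? ×-⇔ ⇔-trans T-∧ (T-⌊⌋ D? ×-⇔ ⇔-trans T-∧ (T-⌊⌋ E? ×-⇔ T-⌊⌋ F?)))))
  where
  T-⌊⌋ : {P : Set} (P? : Dec P) → T ⌊ P? ⌋ ⇔ P
  T-⌊⌋ P? = mk⇔ (toWitness {a? = P?}) (fromWitness {a? = P?})

-- For t = m - 1 both parts of the flag span the same a + 1 rows; the first part supplies column b +
-- 1, the second columns 1 to b.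
inFlag-rectangle : ∀ a b r c →
  inFlag (suc (a + b)) (suc b) b (suc r) (suc c) ≡ (r <ᵇ suc a) ∧ (c <ᵇ suc b)
inFlag-rectangle a b r c = ⇔⇒≡ (rect ∘ Equivalence.to flag) (Equivalence.from flag ∘ unrect)
  where
  Flag : Set
  Flag = (suc c ≡ suc b × 1 ≤ suc r × suc r ≤ suc (a + b) ∸ b)
    ⊎ (1 ≤ suc r × suc r ≤ (a + b ∸ b) + 1 × suc b ∸ b ≤ suc c × suc c ≤ b)

  flag : T (inFlag (suc (a + b)) (suc b) b (suc r) (suc c)) ⇔ Flag
  flag = flag-⇔ (suc c ℕ.≟ suc b) (1 ℕ.≤? suc r) (suc r ℕ.≤? suc (a + b) ∸ b)
    (suc r ℕ.≤? (a + b ∸ b) + 1) (suc b ∸ b ℕ.≤? suc c) (suc c ℕ.≤? b)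

  n-t : suc (a + b) ∸ b ≡ suc a
  n-t = ℕ.m+n∸n≡m (suc a) b

  n-m : (a + b ∸ b) + 1 ≡ suc a
  n-m = trans (cong (_+ 1) (ℕ.m+n∸n≡m a b)) (ℕ.+-comm a 1)

  m-t : suc b ∸ b ≡ 1
  m-t = ℕ.m+n∸n≡m 1 b

  rect : Flag → T ((r <ᵇ suc a) ∧ (c <ᵇ suc b))
  rect (inj₁ (c≡b , _ , r≤)) = Equivalence.from T-∧
    (ℕ.<⇒<ᵇ (subst (suc r ≤_) n-t r≤) , ℕ.<⇒<ᵇ (ℕ.≤-reflexive c≡b))
  rect (inj₂ (_ , r≤ , _ , c≤)) = Equivalence.from T-∧
    (ℕ.<⇒<ᵇ (subst (suc r ≤_) n-m r≤) , ℕ.<⇒<ᵇ (ℕ.m≤n⇒m≤1+n c≤))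

  unrect : T ((r <ᵇ suc a) ∧ (c <ᵇ suc b)) → Flag
  unrect h with Equivalence.to (T-∧ {r <ᵇ suc a}) h
  ... | r<ᵇ , c<ᵇ with ℕ.<ᵇ⇒< r (suc a) r<ᵇ | ℕ.m≤n⇒m<n∨m≡n (ℕ.<ᵇ⇒< c (suc b) c<ᵇ)
  ... | r≤a | inj₁ c<b = inj₂ (s≤s z≤n , subst (suc r ≤_) (sym n-m) r≤a ,
    subst (_≤ suc c) (sym m-t) (s≤s z≤n) , s≤s⁻¹ c<b)
  ... | r≤a | inj₂ c≡b = inj₁ (c≡b , s≤s z≤n , subst (suc r ≤_) (sym n-t) r≤a)

opposed : (a b : ℕ) → Permutation′ n → Fin n → Bool
opposed a b π i = not (toℕ i <ᵇ suc a) ∧ not (toℕ (π ⟨$⟩ʳ i) <ᵇ suc b)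

-- Inclusion–exclusion: a + 1 rows and b + 1 columns meet the flag, out of a + b + 1.
onesInFlag≡1+opposed : ∀ a b (π : Permutation′ (suc (a + b))) →
  onesInFlag (suc (a + b)) (suc b) b π ≡ suc (sumℕ (indicator ∘ opposed a b π))
-- Adding n, as a sum of ones over the rows, avoids subtraction and lets inclusion-exclusion be
-- checked row by row.
onesInFlag≡1+opposed a b π = ℕ.+-cancelʳ-≡ (suc (a + b)) _ _ (begin
  onesInFlag (suc (a + b)) (suc b) b π + suc (a + b)
    ≡⟨ cong₂ _+_ (length-filter-tabulate (λ i → InFlag _ (suc b) b i (π ⟨$⟩ʳ i)) (λ i → i)) (sym (sumℕ-ones (suc (a + b)))) ⟩
  sumℕ flag + sumℕ {suc (a + b)} (λ _ → 1)
    ≡⟨ ℕΣ.∑-distrib-+ flag (λ _ → 1) ⟨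
  sumℕ (λ i → flag i + 1)
    ≡⟨ ℕΣ.sum-cong-≗ pointwise ⟩
  sumℕ (λ i → row i + col (π ⟨$⟩ʳ i) + opp i)
    ≡⟨ trans (ℕΣ.∑-distrib-+ (λ i → row i + col (π ⟨$⟩ʳ i)) opp)
         (cong (_+ sumℕ opp) (ℕΣ.∑-distrib-+ row (col ∘ (π ⟨$⟩ʳ_)))) ⟩
  sumℕ row + sumℕ (col ∘ (π ⟨$⟩ʳ_)) + sumℕ opp
    -- Each column is met exactly once, so the count over rows becomes a count over columns.
    ≡⟨ cong (λ s → sumℕ row + s + sumℕ opp) (ℕΣ.sum-permute col π) ⟨
  sumℕ row + sumℕ col + sumℕ opp
    ≡⟨ cong₂ (λ x y → x + y + sumℕ opp) (sumℕ-initial (s≤s (ℕ.m≤m+n a b))) (sumℕ-initial (s≤s (ℕ.m≤n+m b a))) ⟩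
  suc a + suc b + sumℕ opp
    ≡⟨ arith a b (sumℕ opp) ⟩
  suc (sumℕ opp) + suc (a + b) ∎)
  where
  open ≡-Reasoning
  flag opp row col : Fin (suc (a + b)) → ℕ
  flag i = indicator (InFlag (suc (a + b)) (suc b) b i (π ⟨$⟩ʳ i))
  opp = indicator ∘ opposed a b π
  row i = indicator (toℕ i <ᵇ suc a)
  col j = indicator (toℕ j <ᵇ suc b)
  booleans : ∀ x y → indicator (x ∧ y) + 1 ≡ indicator x + indicator y + indicator (not x ∧ not y)
  booleans true  true  = refl
  booleans true  false = refl
  booleans false true  = refl
  booleans false false = refl
  pointwise : ∀ i → flag i + 1 ≡ row i + col (π ⟨$⟩ʳ i) + opp i
  pointwise i = trans
    (cong (λ x → indicator x + 1) (inFlag-rectangle a b (toℕ i) (toℕ (π ⟨$⟩ʳ i))))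
    (booleans (toℕ i <ᵇ suc a) (toℕ (π ⟨$⟩ʳ i) <ᵇ suc b))
  arith : ∀ a b s → suc a + suc b + s ≡ suc s + suc (a + b)
  arith = solve-∀

AvoidsOpposed : (a b : ℕ) → Permutation′ n → Set
AvoidsOpposed a b π = ∀ i → a < toℕ i → b < toℕ (π ⟨$⟩ʳ i) → ⊥

≮ᵇ : ∀ {x y} → y ≤ x → (x <ᵇ y) ≡ false
≮ᵇ {x} {y} y≤x with x <ᵇ y in eq
... | false = refl
... | true  = contradiction (ℕ.<ᵇ⇒< x y (subst T (sym eq) tt)) (ℕ.≤⇒≯ y≤x)

onesInFlag≡1⇒avoidsOpposed : ∀ a b (π : Permutation′ (suc (a + b))) →
  onesInFlag (suc (a + b)) (suc b) b π ≡ 1 → AvoidsOpposed a b π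
onesInFlag≡1⇒avoidsOpposed a b π ones≡1 i a<i b<πi with
  sumℕ≡0⇒all≡0 (indicator ∘ opposed a b π) (ℕ.suc-injective (trans (sym (onesInFlag≡1+opposed a b π)) ones≡1)) i
... | opp≡0 rewrite ≮ᵇ a<i | ≮ᵇ b<πi with () ← opp≡0

avoidsOpposed⇒onesInFlag≡1 : ∀ a b (π : Permutation′ (suc (a + b))) →
  AvoidsOpposed a b π → onesInFlag (suc (a + b)) (suc b) b π ≡ 1
avoidsOpposed⇒onesInFlag≡1 a b π avoids = trans (onesInFlag≡1+opposed a b π)
  (cong suc (trans (ℕΣ.sum-cong-≗ opp≡0) (ℕΣ.sum-replicate-zero (suc (a + b)))))
  where
  opp≡0 : ∀ i → indicator (opposed a b π i) ≡ 0
  opp≡0 i with toℕ i ℕ.≤? a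
  ... | yes i≤a rewrite Equivalence.to T-≡ (ℕ.<⇒<ᵇ (s≤s i≤a)) = refl
  ... | no i≰a with toℕ (π ⟨$⟩ʳ i) ℕ.≤? b
  ...   | yes πi≤b rewrite Equivalence.to T-≡ (ℕ.<⇒<ᵇ (s≤s πi≤b)) = cong indicator (∧-zeroʳ _)
  ...   | no πi≰b = contradiction (avoids i (ℕ.≰⇒> i≰a) (ℕ.≰⇒> πi≰b)) λ ()

-- Insertions into the identity

insert-hit : ∀ (i j : Fin (suc n)) → insert i j id ⟨$⟩ʳ i ≡ j
insert-hit i j with i Fin.≟ i
... | yes _ = refl
... | no i≢i = contradiction refl i≢i

m≤punchIn : ∀ i (k : Fin n) → toℕ k ≤ toℕ (punchIn i k)
m≤punchIn zero    k       = ℕ.n≤1+n (toℕ k)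
m≤punchIn (suc i) zero    = z≤n
m≤punchIn (suc i) (suc k) = s≤s (m≤punchIn i k)

punchIn≤1+m : ∀ i (k : Fin n) → toℕ (punchIn i k) ≤ suc (toℕ k)
punchIn≤1+m zero    k       = ℕ.≤-refl
punchIn≤1+m (suc i) zero    = z≤n
punchIn≤1+m (suc i) (suc k) = s≤s (punchIn≤1+m i k)

-- `punchIn i` shifts exactly the indices from `i` on, so a smaller hole shifts more of them.
punchIn-antitone : ∀ {i j} (k : Fin n) → toℕ j ≤ toℕ i → toℕ (punchIn i k) ≤ toℕ (punchIn j k)
punchIn-antitone {i = i} {zero} k       _         = punchIn≤1+m i k
punchIn-antitone {i = suc i} {suc j} zero    _         = z≤n
punchIn-antitone {i = suc i} {suc j} (suc k) (s≤s j≤i) = s≤s (punchIn-antitone k j≤i)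

-- The `k`-th row other than `i` goes to the `k`-th column other than `j`; both enumerations
-- increase, hence monotonicity off row `i`.
data InsertView (i j r : Fin (suc n)) : Set where
  special : i ≡ r → insert i j id ⟨$⟩ʳ r ≡ j → InsertView i j r
  other   : ∀ k → punchIn i k ≡ r → insert i j id ⟨$⟩ʳ r ≡ punchIn j k → InsertView i j r

insertView : ∀ (i j r : Fin (suc n)) → InsertView i j r
insertView i j = cover {P = InsertView i j} i
  (special refl (insert-hit i j)) (λ k → other k refl (insert-punchIn i j id k))

-- One pair per permutation: all diagonal pairs give the identity, represented by `corner`, and
-- neighbours give the same transposition in either order, so `above` asks for a gap of two.
data Shape {n} : Fin (suc n) → Fin (suc n) → Set where
  corner : Shape zero zero
  below  : ∀ {i j} → toℕ j < toℕ i → Shape i j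
  above  : ∀ {i j} → suc (toℕ i) < toℕ j → Shape i j

-- The order of elimination: a cell of shape `above` is hit by no other insertion, one of shape
-- `below` possibly by insertions of shape `above`, the corner possibly by both kinds.
rank : ∀ {i j : Fin (suc n)} → Shape i j → ℕ
rank corner    = 2
rank (below _) = 1
rank (above _) = 0

-- Off its special row an insertion moves a row by at most one, and upwards
-- (downwards) only if the special row moves the other way.
hit⇒same : ∀ {i j i′ j′ : Fin (suc n)} (s : Shape i j) (s′ : Shape i′ j′) → rank s ≤ rank s′ →
           insert i′ j′ id ⟨$⟩ʳ i ≡ j → i′ ≡ i × j′ ≡ j
hit⇒same {i = i} {i′ = i′} {j′} s s′ s≤s′ hit with insertView i′ j′ i
... | special i′≡i eq = i′≡i , trans (sym eq) hit
... | other k ↑k≡i eq = contradiction s≤s′ (off s s′ ↑k≡i (trans (sym eq) hit))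
  where
  off : ∀ {n} {i j i′ j′ : Fin (suc n)} {k} (s : Shape i j) (s′ : Shape i′ j′) →
        punchIn i′ k ≡ i → punchIn j′ k ≡ j → ¬ (rank s ≤ rank s′)
  off corner corner () _
  off corner (below _) _ _ (s≤s ())
  off (below j<i) corner refl refl _ = ℕ.<-irrefl refl j<i
  off {k = k} (below j<i) (below j′<i′) refl refl _ = ℕ.<⇒≱ j<i (punchIn-antitone k (ℕ.<⇒≤ j′<i′))
  off {i′ = i′} {j′} {k} (above 1+i<j) _ refl refl _ =
    ℕ.<⇒≱ 1+i<j (ℕ.≤-trans (punchIn≤1+m j′ k) (s≤s (m≤punchIn i′ k)))

-- Reversed insertions: membership in the face and independence

insertReversed : Fin (suc n) → Fin (suc n) → Permutation′ (suc n)
insertReversed i j = insert i j id ∘ₚ reverse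

opposite-cancel-< : (i j : Fin n) → toℕ (opposite i) < toℕ (opposite j) → toℕ j < toℕ i
opposite-cancel-< {n} i j lt =
  s≤s⁻¹ (ℕ.∸-cancelʳ-< {o = n} (subst₂ _<_ (opposite-prop i) (opposite-prop j) lt))

opposite-injective : Injective _≡_ _≡_ (opposite {n})
opposite-injective {x = i} {y = j} eq =
  trans (sym (opposite-involutive i)) (trans (cong opposite eq) (opposite-involutive j))

-- Off row `i` the insertion increases, and reversing the columns makes it decrease.
insertReversed-descent : ∀ (i j r s : Fin (suc n)) → i ≢ r → i ≢ s → toℕ r < toℕ s →
  ¬ (toℕ (insertReversed i j ⟨$⟩ʳ r) < toℕ (insertReversed i j ⟨$⟩ʳ s))
insertReversed-descent i j r s i≢r i≢s r<s ascent with insertView i j r | insertView i j s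
... | special i≡r _ | _ = i≢r i≡r
... | other _ _ _ | special i≡s _ = i≢s i≡s
... | other k refl eq | other l refl eq′ =
  ℕ.<⇒≱ (opposite-cancel-< _ _ ascent)
    (subst₂ (λ x y → toℕ x ≤ toℕ y) (sym eq) (sym eq′)
      (punchIn-mono-≤ j k l (punchIn-cancel-≤ i k l (ℕ.<⇒≤ r<s))))

-- Two of the three rows of a pattern differ from `i`, and they would form an ascent.
insertReversed-avoids123 : ∀ (i j : Fin (suc n)) → Avoids123 (insertReversed i j)
insertReversed-avoids123 i j (i₁ , i₂ , i₃ , _ , _ , _ , i₁<i₂ , i₂<i₃ , j₁<j₂ , j₂<j₃ , refl , refl , refl) =
  go (i Fin.≟ i₁) (i Fin.≟ i₂)
  where
  go : Dec (i ≡ i₁) → Dec (i ≡ i₂) → ⊥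
  go (yes refl) _ = insertReversed-descent i j i₂ i₃
    (λ { refl → ℕ.<-irrefl refl i₁<i₂ }) (λ { refl → ℕ.<-asym i₁<i₂ i₂<i₃ }) i₂<i₃ j₂<j₃
  go (no i≢i₁) (no i≢i₂) = insertReversed-descent i j i₁ i₂ i≢i₁ i≢i₂ i₁<i₂ j₁<j₂
  go (no i≢i₁) (yes refl) = insertReversed-descent i j i₁ i₃
    i≢i₁ (λ { refl → ℕ.<-irrefl refl i₂<i₃ }) (ℕ.<-trans i₁<i₂ i₂<i₃) (ℕ.<-trans j₁<j₂ j₂<j₃)

-- Before reversal the block is rows > a, columns < a. A row > a other than `i` has position `k` ≥ a
-- among the remaining rows and goes to a column ≥ `k`, so only the cell (i , j) could lie in the
-- block.
insertReversed-avoidsOpposed : ∀ a b (i j : Fin (suc (a + b))) →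
  ¬ (a < toℕ i × toℕ j < a) → AvoidsOpposed a b (insertReversed i j)
insertReversed-avoidsOpposed a b i j ok r a<r b<πr = go (insertView i j r)
  where
  w = insert i j id ⟨$⟩ʳ r
  w<a : toℕ w < a
  w<a = ℕ.∸-cancelʳ-< {o = a + b} (subst₂ _<_ (sym (ℕ.m+n∸m≡n a b)) (opposite-prop w) b<πr)
  go : InsertView i j r → ⊥
  go (special refl eq) = ok (a<r , subst (λ x → toℕ x < a) eq w<a)
  go (other k refl eq) = ℕ.<⇒≱ (subst (λ x → toℕ x < a) eq w<a)
    (ℕ.≤-trans (s≤s⁻¹ (ℕ.≤-trans a<r (punchIn≤1+m i k))) (m≤punchIn j k))

insertReversed-onFace : ∀ a b (i j : Fin (suc (a + b))) → ¬ (a < toℕ i × toℕ j < a) →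
  OnFace (suc (a + b)) (suc b) b (insertReversed i j)
insertReversed-onFace a b i j ok = insertReversed-avoids123 i j ,
  avoidsOpposed⇒onesInFlag≡1 a b (insertReversed i j) (insertReversed-avoidsOpposed a b i j ok)

insertReversed-linIndep : (E : Fin k → Fin (suc n) × Fin (suc n)) → Injective _≡_ _≡_ E →
  (∀ x → Shape (proj₁ (E x)) (proj₂ (E x))) →
  LinIndep (λ x → permMatrix (insertReversed (proj₁ (E x)) (proj₂ (E x))))
insertReversed-linIndep E E-inj shape = triangular⇒linIndep _
  (λ x → rank (shape x)) (proj₁ ∘ E) (opposite ∘ proj₂ ∘ E)
  (λ x → permMatrix-hit (P x) (cong opposite (insert-hit (proj₁ (E x)) (proj₂ (E x)))))
  (λ x y y≢x x≤y → permMatrix-miss (P y) λ hit →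
    let i≡ , j≡ = hit⇒same (shape x) (shape y) x≤y (opposite-injective hit)
    in y≢x (E-inj (cong₂ _,_ i≡ j≡)))
  where
  P = λ x → insertReversed (proj₁ (E x)) (proj₂ (E x))

-- Indexing the free cells of the minor

-- The cell (p , q) of the minor without first row and last column is the
-- matrix position (p + 1 , q). Strictly above the subdiagonal it is moved to
-- (p , q + 1), which skips the superdiagonal: the insertion at (p , p + 1) is
-- the transposition already obtained at (p + 1 , p).
ends : ∀ {p q : Fin n} → Dec (toℕ q ≤ toℕ p) → Fin (suc n) × Fin (suc n)
ends {p = p} {q} (yes _) = suc p , inject₁ q
ends {p = p} {q} (no _)  = inject₁ p , suc q

ends-shape : ∀ {p q : Fin n} (d : Dec (toℕ q ≤ toℕ p)) → Shape (proj₁ (ends d)) (proj₂ (ends d))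
ends-shape {q = q} (yes q≤p) = below (s≤s (subst (_≤ _) (sym (toℕ-inject₁ q)) q≤p))
ends-shape {p = p} (no q≰p)  = above (s≤s (subst (_< _) (sym (toℕ-inject₁ p)) (ℕ.≰⇒> q≰p)))

-- A common image would lie both below and above the diagonal.
ends-disjoint : ∀ {p q p′ q′ : Fin n} (q≤p : toℕ q ≤ toℕ p) (q′≰p′ : ¬ (toℕ q′ ≤ toℕ p′)) →
                ends {p = p} {q} (yes q≤p) ≢ ends {p = p′} {q′} (no q′≰p′)
ends-disjoint {p = p} {q} {p′} {q′} q≤p q′≰p′ eq with ,-injective eq
... | p≡ , q≡ = q′≰p′ (begin
  toℕ q′        ≤⟨ ℕ.n≤1+n _ ⟩
  suc (toℕ q′)  ≡⟨ trans (sym (toℕ-inject₁ q)) (cong toℕ q≡) ⟨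
  toℕ q         ≤⟨ q≤p ⟩
  toℕ p         ≤⟨ ℕ.n≤1+n _ ⟩
  suc (toℕ p)   ≡⟨ trans (cong toℕ p≡) (toℕ-inject₁ p′) ⟩
  toℕ p′        ∎)
  where open ℕ.≤-Reasoning

ends-injective : ∀ {p q p′ q′ : Fin n} (d : Dec (toℕ q ≤ toℕ p)) (d′ : Dec (toℕ q′ ≤ toℕ p′)) →
                 ends d ≡ ends d′ → (p , q) ≡ (p′ , q′)
ends-injective (yes _) (yes _) eq with ,-injective eq
... | p≡ , q≡ = cong₂ _,_ (Fin.suc-injective p≡) (inject₁-injective q≡)
ends-injective (no _) (no _) eq with ,-injective eq
... | p≡ , q≡ = cong₂ _,_ (inject₁-injective p≡) (Fin.suc-injective q≡)
ends-injective (yes q≤p) (no q′≰p′) eq = contradiction eq (ends-disjoint q≤p q′≰p′)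
ends-injective (no q≰p) (yes q′≤p′) eq = contradiction (sym eq) (ends-disjoint q′≤p′ q≰p)

Free : ℕ → Fin n × Fin n → Set
Free a (p , q) = toℕ p < a ⊎ a ≤ toℕ q

-- The block is at the lower left, so moving a free cell up and to the right cannot carry it inside.
ends-free : ∀ {p q : Fin n} (d : Dec (toℕ q ≤ toℕ p)) → Free a (p , q) →
            ¬ (a < toℕ (proj₁ (ends d)) × toℕ (proj₂ (ends d)) < a)
ends-free {p = p} {q} (yes _) free (a≤p , q<a) rewrite toℕ-inject₁ q =
  [ ℕ.≤⇒≯ (s≤s⁻¹ a≤p) , ℕ.<⇒≱ q<a ]′ free
ends-free {p = p} {q} (no _) free (a<p , q<a) rewrite toℕ-inject₁ p =
  [ ℕ.<-asym a<p , ℕ.<⇒≱ (ℕ.<-trans (ℕ.n<1+n _) q<a) ]′ free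

-- The first `a` rows of the minor are entirely free; each of the other `b` rows keeps its last `b`
-- cells.
freeCount : ℕ → ℕ → ℕ
freeCount a b = a * (a + b) + b * b

FreeIndex : ℕ → ℕ → Set
FreeIndex a b = (Fin a × Fin (a + b)) ⊎ (Fin b × Fin b)

freeIndex : ∀ a b → Fin (freeCount a b) ↔ FreeIndex a b
freeIndex a b = ↔-trans (+↔⊎ {a * (a + b)}) (*↔× ⊎-↔ *↔×)

position : ∀ a b → FreeIndex a b → Fin (a + b) × Fin (a + b)
position a b (inj₁ (i , q)) = i ↑ˡ b , q
position a b (inj₂ (i , j)) = a ↑ʳ i , a ↑ʳ j

position-free : ∀ a b x → Free a (position a b x)
position-free a b (inj₁ (i , q)) = inj₁ (subst (_< a) (sym (toℕ-↑ˡ i b)) (toℕ<n i))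
position-free a b (inj₂ (i , j)) = inj₂ (subst (a ≤_) (sym (toℕ-↑ʳ a j)) (ℕ.m≤m+n a _))

position-injective : ∀ a b x y → position a b x ≡ position a b y → x ≡ y
position-injective a b (inj₁ (i , q)) (inj₁ (i′ , q′)) eq with ,-injective eq
... | i≡ , q≡ = cong inj₁ (cong₂ _,_ (↑ˡ-injective b i i′ i≡) q≡)
position-injective a b (inj₂ (i , j)) (inj₂ (i′ , j′)) eq with ,-injective eq
... | i≡ , j≡ = cong inj₂ (cong₂ _,_ (↑ʳ-injective a i i′ i≡) (↑ʳ-injective a j j′ j≡))
position-injective a b (inj₁ (i , q)) (inj₂ (i′ , j′)) eq
  with () ← trans (sym (splitAt-↑ˡ a i b)) (trans (cong (splitAt a) (proj₁ (,-injective eq))) (splitAt-↑ʳ a b i′))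
position-injective a b (inj₂ (i , j)) (inj₁ (i′ , q′)) eq
  with () ← trans (sym (splitAt-↑ˡ a i′ b)) (trans (cong (splitAt a) (sym (proj₁ (,-injective eq)))) (splitAt-↑ʳ a b i))

position-surjective : ∀ a b p q → Free a (p , q) → ∃ λ x → position a b x ≡ (p , q)
position-surjective a b p q free with splitAt a p in p-eq
... | inj₁ i = inj₁ (i , q) , cong (_, q) (splitAt⁻¹-↑ˡ p-eq)
... | inj₂ i with splitAt a q in q-eq
...   | inj₂ j = inj₂ (i , j) , cong₂ _,_ (splitAt⁻¹-↑ʳ p-eq) (splitAt⁻¹-↑ʳ q-eq)
...   | inj₁ j = contradiction free [ ℕ.≤⇒≯ a≤p , ℕ.<⇒≱ q<a ]′
  where
  a≤p : a ≤ toℕ p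
  a≤p = subst (λ p → a ≤ toℕ p) (splitAt⁻¹-↑ʳ p-eq) (subst (a ≤_) (sym (toℕ-↑ʳ a i)) (ℕ.m≤m+n a _))
  q<a : toℕ q < a
  q<a = subst (λ q → toℕ q < a) (splitAt⁻¹-↑ˡ q-eq) (subst (_< a) (sym (toℕ-↑ˡ j b)) (toℕ<n j))

cell : ∀ a b → Fin (freeCount a b) → Fin (a + b) × Fin (a + b)
cell a b = position a b ∘ Inverse.to (freeIndex a b)

cell-injective : ∀ a b → Injective _≡_ _≡_ (cell a b)
cell-injective a b {x} {y} eq = begin
  x                      ≡⟨ Inverse.strictlyInverseʳ (freeIndex a b) x ⟨
  from (to x)            ≡⟨ cong from (position-injective a b (to x) (to y) eq) ⟩
  from (to y)            ≡⟨ Inverse.strictlyInverseʳ (freeIndex a b) y ⟩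
  y                      ∎
  where
  open ≡-Reasoning
  open Inverse (freeIndex a b) using (to; from)

cell-surjective : ∀ a b p q → Free a (p , q) → ∃ λ x → cell a b x ≡ (p , q)
cell-surjective a b p q free with position-surjective a b p q free
... | x , eq = Inverse.from (freeIndex a b) x ,
  trans (cong (position a b) (Inverse.strictlyInverseˡ (freeIndex a b) x)) eq

-- The lower and the upper bound

independentFamily : ∀ a b →
  Σ (Fin (suc (freeCount a b)) → Permutation′ (suc (a + b))) λ F →
    (∀ x → OnFace (suc (a + b)) (suc b) b (F x)) × LinIndep (λ x → permMatrix (F x))
independentFamily a b =
  (λ x → insertReversed (proj₁ (E x)) (proj₂ (E x))) ,
  (λ x → insertReversed-onFace a b _ _ (E-free x)) ,
  insertReversed-linIndep E E-injective E-shape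
  where
  dec : ∀ x → Dec (toℕ (proj₂ (cell a b x)) ≤ toℕ (proj₁ (cell a b x)))
  dec x = _ ℕ.≤? _
  E : Fin (suc (freeCount a b)) → Fin (suc (a + b)) × Fin (suc (a + b))
  -- The additional index carries the identity, whose reversal is the antidiagonal matrix.
  E zero    = zero , zero
  E (suc x) = ends (dec x)
  E-free : ∀ x → ¬ (a < toℕ (proj₁ (E x)) × toℕ (proj₂ (E x)) < a)
  E-free zero    (() , _)
  E-free (suc x) = ends-free (dec x) (position-free a b (Inverse.to (freeIndex a b) x))
  E-shape : ∀ x → Shape (proj₁ (E x)) (proj₂ (E x))
  E-shape zero    = corner
  E-shape (suc x) = ends-shape (dec x)
  ends≢corner : ∀ {n} {p q : Fin n} (d : Dec (toℕ q ≤ toℕ p)) → ends d ≢ (zero , zero)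
  ends≢corner (yes _) ()
  ends≢corner (no _)  ()
  E-injective : Injective _≡_ _≡_ E
  E-injective {zero}  {zero}  _  = refl
  E-injective {zero}  {suc y} eq = contradiction (sym eq) (ends≢corner (dec y))
  E-injective {suc x} {zero}  eq = contradiction eq (ends≢corner (dec x))
  E-injective {suc x} {suc y} eq = cong suc (cell-injective a b (ends-injective (dec x) (dec y) eq))

-- Each matrix is recorded by a constant 1 and its free entries; a relation among these vectors
-- extends to the matrices.
independent⇒bounded : ∀ a b k (F : Fin k → Permutation′ (suc (a + b))) →
  (∀ x → OnFace (suc (a + b)) (suc b) b (F x)) → LinIndep (λ x → permMatrix (F x)) →
  k ≤ suc (freeCount a b)
independent⇒bounded a b k F face indep = ℕ.≮⇒≥ λ d<k →
  let c , (x , cₓ≢0) , Σ≡0 = dependent (suc (freeCount a b)) d<k v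
      Σc≡0 = trans (sum-cong-≗ (λ x → sym (ℚ.*-identityʳ (c x)))) (Σ≡0 zero)
  in cₓ≢0 (indep c (λ i j → trans (sumFin≡sum k _) (zeroMinor⇒dependent F c Σc≡0 (minor c (Σ≡0 ∘ suc)) i j)) x)
  where
  entry : Fin (a + b) × Fin (a + b) → Fin k → ℚ
  -- Free cells are indexed with columns reversed, hence `opposite q`; both `suc` skip the first row
  -- and column.
  entry (p , q) x = permMatrix (F x) (suc p) (suc (opposite q))
  v : Fin k → Fin (suc (freeCount a b)) → ℚ
  -- This coordinate forces the coefficients of a relation to sum to zero, as `zeroMinor⇒dependent`
  -- requires.
  v x zero    = 1ℚ
  v x (suc y) = entry (cell a b y) x
  module _ (c : Fin k → ℚ) (Σ≡0 : ∀ y → sum (λ x → c x ℚ.* entry (cell a b y) x) ≡ 0ℚ) where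
    oppositeMinor : ∀ p q → sum (λ x → c x ℚ.* entry (p , q) x) ≡ 0ℚ
    oppositeMinor p q with toℕ p ℕ.<? a | a ℕ.≤? toℕ q
    ... | yes p<a | _ = let y , eq = cell-surjective a b p q (inj₁ p<a) in
      subst (λ z → sum (λ x → c x ℚ.* entry z x) ≡ 0ℚ) eq (Σ≡0 y)
    ... | _ | yes a≤q = let y , eq = cell-surjective a b p q (inj₂ a≤q) in
      subst (λ z → sum (λ x → c x ℚ.* entry z x) ≡ 0ℚ) eq (Σ≡0 y)
    -- The cell lies in the opposite block, where every matrix of the face vanishes.
    ... | no p≮a | no a≰q = sum-zero _ λ x →
      trans (cong (c x ℚ.*_) (permMatrix-miss (F x) λ hit →
        onesInFlag≡1⇒avoidsOpposed a b (F x) (proj₂ (face x)) (suc p) (s≤s (ℕ.≮⇒≥ p≮a))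
          (subst (λ j → b < toℕ j) (sym hit) (s≤s b≤q))))
        (ℚ.*-zeroʳ (c x))
      where
      b≤q : b ≤ toℕ (opposite q)
      b≤q = subst (b ≤_) (sym (opposite-prop q))
        (subst (_≤ a + b ∸ suc (toℕ q)) (ℕ.m+n∸m≡n a b) (ℕ.∸-monoʳ-≤ (a + b) (ℕ.≰⇒> a≰q)))
    minor : ∀ i j → sum (λ x → c x ℚ.* permMatrix (F x) (suc i) (suc j)) ≡ 0ℚ
    minor i j = subst (λ j → sum (λ x → c x ℚ.* permMatrix (F x) (suc i) (suc j)) ≡ 0ℚ)
      (opposite-involutive j) (oppositeMinor i (opposite j))

freeCount-formula : ∀ a b → suc (freeCount a b) ≡ ((a + b) ^ 2 + 1) ∸ b * (a + b ∸ b)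
freeCount-formula a b = begin
  suc (freeCount a b)                      ≡⟨ ℕ.m+n∸n≡m (suc (freeCount a b)) (b * a) ⟨
  suc (freeCount a b) + b * a ∸ b * a      ≡⟨ cong₂ _∸_ (square a b) (cong (b *_) (sym (ℕ.m+n∸n≡m a b))) ⟩
  (a + b) ^ 2 + 1 ∸ b * (a + b ∸ b)        ∎
  where
  open ≡-Reasoning
  -- The square appears as `_^ 2` unfolds, and `b * a` is added to keep truncated subtraction out of
  -- the ring identity.
  square : ∀ a b → suc (a * (a + b) + b * b) + b * a ≡ (a + b) * ((a + b) * 1) + 1
  square = solve-∀

theorem4p6 : (n m : ℕ) → 1 ≤ n → 1 ≤ m → m ≤ n →
    MaxIndepCount n m (m ∸ 1) (((n ∸ 1) ^ 2 + 1) ∸ ((m ∸ 1) * (n ∸ m)))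
theorem4p6 (suc n) (suc b) _ _ (s≤s b≤n) =
  -- Here a = n - m in the original variables, that is `n ∸ b`; the transport replaces `n ∸ b + b`
  -- by `n`.
  subst (λ n → MaxIndepCount (suc n) (suc b) b ((n ^ 2 + 1) ∸ b * (n ∸ b))) (ℕ.m∸n+n≡m b≤n)
    (subst (MaxIndepCount (suc (n ∸ b + b)) (suc b) b) (freeCount-formula (n ∸ b) b)
      (independentFamily (n ∸ b) b , independent⇒bounded (n ∸ b) b))
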